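{- Let $n\ge 1$ be an integer and let $T_n$ be the triangular grid graph. For every integer $k$ with $0\le k\le |V(T_n)|$ and every $A\subseteq V(T_n)$ with $|A|=k$, \[ |\partial_{T_n}(A)|\ \ge\ \min\bigl\{\,|\partial_{T_n}(R_k)|,\ |\partial_{T_n}(I_k)|\,\bigr\}, \] where $R_k$ is the row packing of size $k$ and $I_k$ is the ice cream cone packing of size $k$.
   Context: The triangular grid graph $T_n$ (the $(n-1)$-th subdivision of a triangle) has vertex set $\{(v_1,v_2)\in\mathbb{Z}_{\ge 0}^2 : v_1+v_2\le n\}$, so $|V(T_n)|=\frac{(n+1)(n+2)}{2}$, and two vertices are adjacent iff they are of the form $(a,b),(a+1,b)$, or $(a,b),(a,b+1)$, or $(a+1,b),(a,b+1)$. Here $v_2$ is the index of the row containing $v$ (row $0$ is the bottom row, with $n+1$ vertices, and row $n$ is the single top vertex), and $v_1$ is the number of vertices of that row to the left of $v$. For a graph $G$ and $S\subseteq V(G)$, the vertex boundary $\partial_G(S)$ is the set of vertices not in $S$ that are adjacent to some vertex of $S$. The row packing of size $k$ is the set of the first $k$ vertices of $T_n$ in the order where $u$ precedes $v$ iff $u_2<v_2$, or $u_2=v_2$ and $u_1<v_1$ (i.e. rows are filled from the bottom up, each row only after the one below it is full, and each row from left to right). A set is the ice cream cone packing of size $k$ if it is the complement in $V(T_n)$ of the row packing of size $|V(T_n)|-k$. -}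

module Defs where

open import Data.Nat using (ℕ; zero; suc; _+_; _∸_; _≤_)
open import Data.Nat.Properties using (_≟_)
open import Data.Product using (_×_; _,_; proj₁; proj₂)
open import Data.Product.Properties using (≡-dec)
open import Data.Sum using (_⊎_)
open import Data.List using (List; []; _∷_; map; concatMap; upTo; filter; length; take; drop)
open import Data.List.Membership.Propositional using (_∈_; _∉_)
open import Data.List.Membership.DecPropositional using () renaming (_∈?_ to ∈?-gen)
open import Data.List.Relation.Unary.Any using (Any; any?)
open import Relation.Binary.PropositionalEquality using (_≡_)
open import Relation.Nullary using (Dec; ¬_)
open import Relation.Nullary.Decidable using (_⊎-dec_; _×-dec_; ¬?)

-- A vertex (v₁ , v₂): v₂ = row index, v₁ = position within the row.
Vertex : Set
Vertex = ℕ × ℕ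

_≟V_ : (u v : Vertex) → Dec (u ≡ v)
_≟V_ = ≡-dec _≟_ _≟_

InT : ℕ → Vertex → Set
InT n (a , b) = a + b ≤ n

row : ℕ → ℕ → List Vertex
row n j = map (λ i → (i , j)) (upTo (suc (n ∸ j)))

vertices : ℕ → List Vertex
vertices n = concatMap (row n) (upTo (suc n))

Edge : Vertex → Vertex → Set
Edge (a , b) (c , d) =
  (c ≡ suc a × d ≡ b) ⊎ ((c ≡ a × d ≡ suc b) ⊎ (a ≡ suc c × d ≡ suc b))

Adj : Vertex → Vertex → Set
Adj u v = Edge u v ⊎ Edge v u

edge? : (u v : Vertex) → Dec (Edge u v)
edge? (a , b) (c , d) =
  ((c ≟ suc a) ×-dec (d ≟ b)) ⊎-dec
  (((c ≟ a) ×-dec (d ≟ suc b)) ⊎-dec ((a ≟ suc c) ×-dec (d ≟ suc b)))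

adj? : (u v : Vertex) → Dec (Adj u v)
adj? u v = edge? u v ⊎-dec edge? v u

_∈V?_ : (v : Vertex) (S : List Vertex) → Dec (v ∈ S)
v ∈V? S = ∈?-gen _≟V_ v S

OnBoundary : List Vertex → Vertex → Set
OnBoundary S v = (v ∉ S) × Any (Adj v) S

onBoundary? : (S : List Vertex) (v : Vertex) → Dec (OnBoundary S v)
onBoundary? S v = ¬? (v ∈V? S) ×-dec any? (adj? v) S

-- Vertex boundary ∂_{T_n}(S), as a duplicate-free list of vertices of T_n.
boundary : ℕ → List Vertex → List Vertex
boundary n S = filter (onBoundary? S) (vertices n)

numVertices : ℕ → ℕ
numVertices n = length (vertices n)

rowPacking : ℕ → ℕ → List Vertex
rowPacking n k = take k (vertices n)

-- Ice cream cone packing of size k: complement of the row packing of size |V| ∸ k.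
iceCream : ℕ → ℕ → List Vertex
iceCream n k = drop (numVertices n ∸ k) (vertices n)

{-# OPTIONS --safe #-}
module Submission where

-- Let p = |∂A|, let B be the set of vertices outside A ∪ ∂A, and let aₜ, sₜ, bₜ be the numbers of
-- vertices of row t in A, ∂A, B; write T(m) for the m-th triangular number. The ice cream cone of
-- size k has boundary at most p when k ≤ T(p − 1), and the row packing does when at most T(p)
-- vertices are left over, so it suffices that |A| ≤ T(p − 1) or |B| ≤ T(p − 1), a statement
-- symmetric in A and B.
--
-- Comparing adjacent rows gives aₜ₊₁ = 0 or aₜ₊₁ < aₜ + sₜ, and aₜ₊₁ = 0 or bₜ ≤ bₜ₊₁ + sₜ₊₁, and
-- the same with a and b exchanged; a row with sₜ = 0 lies in A or in B. If every row meets ∂A, then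
-- p > n and counting suffices. Otherwise let i be the first row missing ∂A, say with row i inside A.
-- If some row below i misses A, the growth of a up to aᵢ = n + 1 − i again forces p > n. If not, the
-- descending inequality bounds Σ_{t ≤ i} bₜ by T(Σ_{t ≤ i} sₜ − 1), and from row i upwards the
-- potential Σ_{u < t} b_u + T(bₜ) stays at most T(Σ_{u < t} s_u − 1).

open import Defs
open import Data.Nat using (ℕ; zero; suc; pred; _+_; _∸_; _≤_; _<_; _⊓_; z≤n; s≤s; s≤s⁻¹; _<?_)
open import Data.Nat.Properties
open import Data.Nat.Solver using (module +-*-Solver)
open import Data.Bool using (if_then_else_)
open import Data.Product using (_×_; _,_; proj₁; proj₂; ∃-syntax)
open import Data.Sum using (_⊎_; inj₁; inj₂; map₂; swap; [_,_]′)
open import Data.Empty using (⊥-elim)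
open import Data.List using (List; []; _∷_; _++_; map; concatMap; upTo; filter; length; drop)
open import Data.List.Properties using
  ( length-map; length-upTo; length-++; length-++-sucʳ; length-drop; take++drop≡id
  ; concatMap-++; filter-++; filter-none; map-++; upTo-∷ʳ; ++-identityʳ)
open import Data.List.Membership.Propositional using (_∈_; _∉_; lose; find)
open import Data.List.Membership.Propositional.Properties using
  ( ∈-∃++; ∈-++⁺ˡ; ∈-++⁺ʳ; ∈-++⁻; ∈-map⁺; ∈-map⁻; ∈-upTo⁺; ∈-upTo⁻
  ; ∈-concatMap⁺; ∈-concatMap⁻; ∈-filter⁺; ∈-filter⁻)
open import Data.List.Relation.Binary.Subset.Propositional using (_⊆_)
open import Data.List.Relation.Unary.Any using (here; there)
open import Data.List.Relation.Unary.All using (All; []; _∷_; tabulate) renaming (lookup to lookupAll)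
open import Data.List.Relation.Unary.All.Properties using (++⁻ˡ) renaming (map⁺ to All-map⁺)
open import Data.List.Relation.Unary.AllPairs using (AllPairs; []; _∷_) renaming (map to mapPairs)
open import Data.List.Relation.Unary.AllPairs.Properties using (concat⁺; applyUpTo⁺₁) renaming (map⁺ to AllPairs-map⁺)
open import Data.List.Relation.Unary.Unique.Propositional using (Unique)
open import Data.List.Relation.Unary.Unique.Propositional.Properties using () renaming (filter⁺ to Unique-filter⁺)
open import Function using (id; _∘_)
open import Relation.Binary.PropositionalEquality using (_≡_; _≢_; refl; sym; trans; cong; cong₂; subst; module ≡-Reasoning)
open import Relation.Nullary using (Dec; yes; no; ¬_)
open import Relation.Nullary.Decidable using (¬?; _×-dec_; dec-true; dec-false; does)
open import Relation.Unary using (Decidable)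

-- Triangular numbers.

Sum : (ℕ → ℕ) → ℕ → ℕ
Sum f zero = 0
Sum f (suc m) = Sum f m + f m

tri : ℕ → ℕ
tri m = Sum suc m

Sum-mono : ∀ f {m k} → m ≤ k → Sum f m ≤ Sum f k
Sum-mono f {k = zero} z≤n = z≤n
Sum-mono f {m} {suc k} m≤ with m≤n⇒m<n∨m≡n m≤
... | inj₁ (s≤s m≤k) = m≤n⇒m≤n+o (f k) (Sum-mono f m≤k)
... | inj₂ refl = ≤-refl

tri-mono : ∀ {m k} → m ≤ k → tri m ≤ tri k
tri-mono = Sum-mono suc

tri-pred : ∀ m → tri (m ∸ 1) + m ≡ tri m
tri-pred zero = refl
tri-pred (suc m) = refl

m≤tri : ∀ m → m ≤ tri m
m≤tri zero = z≤n
m≤tri (suc m) = m≤n+m (suc m) (tri m)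

-- After the common terms are removed, the left side is b + (b + 1) + ... + (b + d) and the right
-- side is (e + 1) + ... + (e + d + 1); these d + 1 terms compare one by one.
tri-convex : ∀ {b e} d → b ≤ e → tri (b + d) + b + tri e ≤ tri b + tri (e + suc d)
tri-convex {b} {e} zero b≤e rewrite +-identityʳ b | +-comm e 1 = begin
  tri b + b + tri e       ≤⟨ +-monoˡ-≤ (tri e) (+-monoʳ-≤ (tri b) (m≤n⇒m≤1+n b≤e)) ⟩
  tri b + suc e + tri e   ≡⟨ +-assoc (tri b) (suc e) (tri e) ⟩
  tri b + (suc e + tri e) ≡⟨ cong (tri b +_) (+-comm (suc e) (tri e)) ⟩
  tri b + (tri e + suc e) ∎
  where open ≤-Reasoning
tri-convex {b} {e} (suc d) b≤e rewrite +-suc b d | +-suc e (suc d) = begin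
  tri (b + d) + suc (b + d) + b + tri e               ≡⟨ solve 4 (λ x y z w → x :+ y :+ z :+ w := x :+ z :+ w :+ y) refl (tri (b + d)) (suc (b + d)) b (tri e) ⟩
  tri (b + d) + b + tri e + suc (b + d)               ≤⟨ +-mono-≤ (tri-convex d b≤e) (s≤s (+-mono-≤ b≤e (n≤1+n d))) ⟩
  tri b + tri (e + suc d) + suc (e + suc d)           ≡⟨ +-assoc (tri b) _ _ ⟩
  tri b + (tri (e + suc d) + suc (e + suc d))         ∎
  where
  open ≤-Reasoning
  open +-*-Solver

-- Row profiles of a separation.

n≡0⊎n>0 : ∀ n → n ≡ 0 ⊎ 0 < n
n≡0⊎n>0 zero = inj₁ refl
n≡0⊎n>0 (suc n) = inj₂ (s≤s z≤n)

-- The length n + 1 − t of row t is moved across the equations, so that no subtraction occurs.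
record Separated (n : ℕ) (a s b : ℕ → ℕ) : Set where
  field
    total   : ∀ {t} → t ≤ n → a t + s t + b t + t ≡ suc n
    pure    : ∀ {t} → t ≤ n → s t ≡ 0 → a t ≡ 0 ⊎ b t ≡ 0
    above-a : ∀ {t} → t < n → a (suc t) ≡ 0 ⊎ a (suc t) + b t + t ≤ n
    above-b : ∀ {t} → t < n → b (suc t) ≡ 0 ⊎ b (suc t) + a t + t ≤ n

Separated-sym : ∀ {n a s b} → Separated n a s b → Separated n b s a
Separated-sym {n} {a} {s} {b} S = record
  { total = λ {t} t≤n → trans (cong (_+ t) (solve 3 (λ x y z → x :+ y :+ z := z :+ y :+ x) refl (b t) (s t) (a t))) (total t≤n)
  ; pure = λ t≤n s≡0 → swap (pure t≤n s≡0)
  ; above-a = above-b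
  ; above-b = above-a
  }
  where
  open Separated S
  open +-*-Solver

extend : ∀ {P : ℕ → Set} {n} → (∀ {t} → t < n → P t) → P n → ∀ {t} → t ≤ n → P t
extend below at t≤n with m≤n⇒m<n∨m≡n t≤n
... | inj₁ t<n = below t<n
... | inj₂ refl = at

Sum-positive : ∀ {s} n → (∀ {t} → t < n → 0 < s t) → n ≤ Sum s n
Sum-positive zero _ = z≤n
Sum-positive (suc n) pos = ≤-trans (≤-reflexive (+-comm 1 n))
  (+-mono-≤ (Sum-positive n (λ t<n → pos (m<n⇒m<1+n t<n))) (pos ≤-refl))

first-zero : ∀ (s : ℕ → ℕ) n →
  (∀ {t} → t < n → 0 < s t) ⊎ ∃[ i ] (i < n × s i ≡ 0 × (∀ {t} → t < i → 0 < s t))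
first-zero s zero = inj₁ λ ()
first-zero s (suc n) with first-zero s n
... | inj₂ (i , i<n , rest) = inj₂ (i , m<n⇒m<1+n i<n , rest)
... | inj₁ pos with n≡0⊎n>0 (s n)
... | inj₁ s≡0 = inj₂ (n , ≤-refl , s≡0 , pos)
... | inj₂ s>0 = inj₁ λ t≤n → extend {λ t → 0 < s t} pos s>0 (s≤s⁻¹ t≤n)

-- The arithmetic of `potential-step` across a row with d + 1 boundary vertices: `x` and `q` stand
-- for the counts of B and of the boundary below that row, and `tri-convex` with e = q - 1 pays for
-- b rising by d.
tri-step : ∀ {x b q} d → x + tri b ≤ tri (q ∸ 1) → b ≤ q ∸ 1 → x + b + tri (b + d) ≤ tri (q + d)
tri-step {x} {q = zero} d h z≤n = +-monoˡ-≤ (tri d) h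
tri-step {x} {b} {suc e} d h b≤e = +-cancelʳ-≤ (tri e) _ _ (begin
  x + b + tri (b + d) + tri e         ≡⟨ solve 4 (λ x y z w → x :+ y :+ z :+ w := x :+ (z :+ y :+ w)) refl x b (tri (b + d)) (tri e) ⟩
  x + (tri (b + d) + b + tri e)       ≤⟨ +-monoʳ-≤ x (tri-convex d b≤e) ⟩
  x + (tri b + tri (e + suc d))       ≡⟨ +-assoc x (tri b) _ ⟨
  x + tri b + tri (e + suc d)         ≤⟨ +-monoˡ-≤ _ h ⟩
  tri e + tri (e + suc d)             ≡⟨ +-comm (tri e) _ ⟩
  tri (e + suc d) + tri e             ≡⟨ cong (λ y → tri y + tri e) (+-suc e d) ⟩
  tri (suc e + d) + tri e             ∎)
  where
  open ≤-Reasoning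
  open +-*-Solver

-- Growth, descent and potential along the rows.

module _ {n a s b} (S : Separated n a s b) where
  open Separated S
  open +-*-Solver

  private
    p : ℕ
    p = Sum s (suc n)

    cancel-level : ∀ {t} → t ≤ n → ∀ x → x + t ≤ n → suc x ≤ a t + s t + b t
    cancel-level {t} t≤n x h = +-cancelʳ-≤ t _ _ (subst (suc (x + t) ≤_) (sym (total t≤n)) (s≤s h))

  -- By `above-a`, at most n - t - a (t + 1) of the n + 1 - t vertices of row t are counted by `b`,
  -- so the others outnumber `a (suc t)`.
  growth-a : ∀ {t} → t < n → a (suc t) ≡ 0 ⊎ suc (a (suc t)) ≤ a t + s t
  growth-a {t} t<n = map₂ (λ h → +-cancelʳ-≤ (b t) _ _ (cancel-level (<⇒≤ t<n) _ h)) (above-a t<n)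

  growth-b : ∀ {t} → t < n → b (suc t) ≡ 0 ⊎ suc (b (suc t)) ≤ b t + s t
  growth-b {t} t<n = map₂ (λ h → +-cancelʳ-≤ (a t) _ _ (≤-trans (cancel-level (<⇒≤ t<n) _ h)
     (≤-reflexive (solve 3 (λ x y z → x :+ y :+ z := z :+ y :+ x) refl (a t) (s t) (b t))))) (above-b t<n)

  -- The same inequality measured against row t + 1, whose length is n - t: what `a (suc t)` leaves
  -- free there is at least `b t`.
  descent-b : ∀ {t} → t < n → a (suc t) ≡ 0 ⊎ b t ≤ b (suc t) + s (suc t)
  descent-b {t} t<n = map₂ bound (above-a t<n)
    where
    bound : a (suc t) + b t + t ≤ n → b t ≤ b (suc t) + s (suc t)
    bound h = +-cancelˡ-≤ (a (suc t)) _ _ (+-cancelʳ-≤ t _ _ (s≤s⁻¹ (begin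
      suc (a (suc t) + b t + t)                               ≤⟨ s≤s h ⟩
      suc n                                                   ≡⟨ total t<n ⟨
      a (suc t) + s (suc t) + b (suc t) + suc t               ≡⟨ solve 4 (λ x y z w → x :+ y :+ z :+ (con 1 :+ w) := con 1 :+ (x :+ (z :+ y) :+ w)) refl (a (suc t)) (s (suc t)) (b (suc t)) t ⟩
      suc (a (suc t) + (b (suc t) + s (suc t)) + t)           ∎)))
      where open ≤-Reasoning

  private
    level : ∀ m d → m + d ≡ n → a m + s m + b m ≡ suc d
    level m d eq = +-cancelʳ-≡ m _ _ (trans (total (m+n≤o⇒m≤o m (≤-reflexive eq))) (cong suc (trans (sym eq) (+-comm m d))))

  -- The d rows from row m upwards have lengths d, ..., 1, so `tri d` counts their vertices.
  Sum-total : ∀ m d → m + d ≡ suc n → Sum a m + Sum s m + Sum b m + tri d ≡ tri (suc n)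
  Sum-total zero d refl = refl
  Sum-total (suc m) d eq = trans
    (trans (solve 7 (λ x y z x′ y′ z′ w → (x :+ x′) :+ (y :+ y′) :+ (z :+ z′) :+ w := x :+ y :+ z :+ (w :+ (x′ :+ y′ :+ z′))) refl
             (Sum a m) (Sum s m) (Sum b m) (a m) (s m) (b m) (tri d))
           (cong (λ x → Sum a m + Sum s m + Sum b m + (tri d + x)) (level m d (suc-injective eq))))
    (Sum-total m (suc d) (trans (+-suc m d) eq))

  -- The grid has T(n + 1) ≤ T(p) vertices. Removing the p boundary vertices leaves at most T(p) - p
  -- = T(p - 1) in A and B together.
  dense : suc n ≤ p → Sum a (suc n) ≤ tri (p ∸ 1)
  dense n<p = +-cancelʳ-≤ p _ _ (begin
    Sum a (suc n) + p                       ≤⟨ m≤m+n _ (Sum b (suc n)) ⟩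
    Sum a (suc n) + p + Sum b (suc n)       ≡⟨ +-identityʳ _ ⟨
    Sum a (suc n) + p + Sum b (suc n) + 0   ≡⟨ Sum-total (suc n) 0 (+-identityʳ _) ⟩
    tri (suc n)                             ≤⟨ tri-mono n<p ⟩
    tri p                                   ≡⟨ tri-pred p ⟨
    tri (p ∸ 1) + p                         ∎)
    where open ≤-Reasoning

  -- A row missing A starts the left alternative, since every row below it contributes a boundary
  -- vertex. From there `growth-a` lets `a` rise by at most s - 1 per row, so `a i + i` rises by at
  -- most `s i`.
  ascent : ∀ {i} → i ≤ n → (∀ {t} → t < i → 0 < s t) →
    a i + i ≤ Sum s i ⊎ (∀ {t} → t ≤ i → 0 < a t)
  ascent {zero} _ _ with n≡0⊎n>0 (a 0)
  ... | inj₁ z = inj₁ (≤-reflexive (trans (+-identityʳ _) z))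
  ... | inj₂ a>0 = inj₂ λ { z≤n → a>0 }
  ascent {suc i} i<n pos with n≡0⊎n>0 (a (suc i))
  ... | inj₁ z = inj₁ (subst (λ x → x + suc i ≤ Sum s (suc i)) (sym z) (Sum-positive (suc i) pos))
  ... | inj₂ a>0 with ascent (<⇒≤ i<n) (λ t<i → pos (m<n⇒m<1+n t<i))
  ... | inj₂ a-pos = inj₂ (extend {λ t → 0 < a t} (λ t<1+i → a-pos (s≤s⁻¹ t<1+i)) a>0)
  ... | inj₁ h with growth-a i<n
  ... | inj₁ z = ⊥-elim (n≮0 (subst (0 <_) z a>0))
  ... | inj₂ g = inj₁ (begin
      a (suc i) + suc i   ≡⟨ +-suc (a (suc i)) i ⟩
      suc (a (suc i)) + i ≤⟨ +-monoˡ-≤ i g ⟩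
      a i + s i + i       ≡⟨ solve 3 (λ x y z → x :+ y :+ z := x :+ z :+ y) refl (a i) (s i) i ⟩
      a i + i + s i       ≤⟨ +-monoˡ-≤ (s i) h ⟩
      Sum s i + s i       ∎)
    where open ≤-Reasoning

  -- Downward induction from row i, with d the distance to it and q the boundary count of rows t to
  -- i. By `descent-b`, `b t` is at most the previous q, so adding row t turns T(q - 1) into at most
  -- T(q), and `0 < s t` fits this under the new bound. The last component feeds the next use of
  -- `descent-b`.
  descent : ∀ {i} → i ≤ n → s i ≡ 0 → b i ≡ 0 →
    (∀ {t} → t < i → 0 < s t) → (∀ {t} → t ≤ i → 0 < a t) →
    ∀ d t → t + d ≡ i →
    ∃[ q ] (Sum s (suc i) ≡ Sum s t + q × Sum b (suc i) ≤ Sum b t + tri (q ∸ 1) × b t + s t ≤ q)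
  descent {i} _ s≡0 b≡0 _ _ zero t eq with refl ← trans (sym (+-identityʳ t)) eq =
    0 , cong (Sum s t +_) s≡0 , ≤-reflexive (cong (Sum b t +_) b≡0) , ≤-reflexive (cong₂ _+_ b≡0 s≡0)
  descent {i} i≤n s≡0 b≡0 s-pos a-pos (suc d) t eq
    with descent i≤n s≡0 b≡0 s-pos a-pos d (suc t) (trans (sym (+-suc t d)) eq)
  ... | q , s-eq , b-le , q-ge =
    s t + q
    , trans s-eq (+-assoc (Sum s t) (s t) q)
    , (begin
        Sum b (suc i)                        ≤⟨ b-le ⟩
        Sum b t + b t + tri (q ∸ 1)          ≡⟨ +-assoc (Sum b t) (b t) _ ⟩
        Sum b t + (b t + tri (q ∸ 1))        ≤⟨ +-monoʳ-≤ (Sum b t) (+-monoˡ-≤ (tri (q ∸ 1)) b≤q) ⟩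
        Sum b t + (q + tri (q ∸ 1))          ≡⟨ cong (Sum b t +_) (trans (+-comm q _) (tri-pred q)) ⟩
        Sum b t + tri q                      ≤⟨ +-monoʳ-≤ (Sum b t) (tri-mono (∸-monoˡ-≤ 1 (+-monoˡ-≤ q (s-pos t<i)))) ⟩
        Sum b t + tri (s t + q ∸ 1)          ∎)
    , ≤-trans (+-monoˡ-≤ (s t) b≤q) (≤-reflexive (+-comm q (s t)))
    where
    open ≤-Reasoning
    t<i : t < i
    t<i = m+n≤o⇒m≤o (suc t) (≤-reflexive (trans (sym (+-suc t d)) eq))
    b≤q : b t ≤ q
    b≤q with descent-b (<-≤-trans t<i i≤n)
    ... | inj₁ z = ⊥-elim (n≮0 (subst (0 <_) z (a-pos t<i)))
    ... | inj₂ h = ≤-trans h q-ge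

  -- If no row from t on met the boundary, `growth-b` would shrink b by at least one per row, so
  -- those rows would hold at most b + (b - 1) + ... + 1 = `tri (b t)` vertices of B. The second
  -- component supplies the hypothesis of `tri-convex`.
  Potential : ℕ → Set
  Potential t = Sum b t + tri (b t) ≤ tri (Sum s t ∸ 1) × b t ≤ Sum s t ∸ 1

  potential-step : ∀ {t} → t < n → Potential t → Potential (suc t)
  potential-step {t} t<n (pot , b≤) with growth-b t<n
  ... | inj₁ z rewrite z = (begin
      Sum b t + b t + 0           ≡⟨ +-identityʳ _ ⟩
      Sum b t + b t               ≤⟨ +-monoʳ-≤ (Sum b t) (m≤tri (b t)) ⟩
      Sum b t + tri (b t)         ≤⟨ pot ⟩
      tri (Sum s t ∸ 1)           ≤⟨ tri-mono (∸-monoˡ-≤ 1 (m≤m+n (Sum s t) (s t))) ⟩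
      tri (Sum s t + s t ∸ 1)     ∎) , z≤n
    where open ≤-Reasoning
  ... | inj₂ g with s t
  -- Without boundary in row t, b drops by at least one, and T(b - 1) + b = T(b) keeps the potential
  -- from rising.
  ... | zero rewrite +-identityʳ (Sum s t) | +-identityʳ (b t) = (begin
      Sum b t + b t + tri (b (suc t))         ≡⟨ +-assoc (Sum b t) (b t) _ ⟩
      Sum b t + (b t + tri (b (suc t)))       ≤⟨ +-monoʳ-≤ (Sum b t) (+-monoʳ-≤ (b t) (tri-mono (∸-monoˡ-≤ 1 g))) ⟩
      Sum b t + (b t + tri (b t ∸ 1))         ≡⟨ cong (Sum b t +_) (trans (+-comm (b t) _) (tri-pred (b t))) ⟩
      Sum b t + tri (b t)                     ≤⟨ pot ⟩
      tri (Sum s t ∸ 1)                       ∎) , ≤-trans (<⇒≤ g) b≤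
    where open ≤-Reasoning
  -- With q = `Sum s t`, b may rise by d while the bound moves from T(q - 1) to T(q + d).
  ... | suc d =
      ≤-trans (+-monoʳ-≤ (Sum b t + b t) (tri-mono b′≤))
        (≤-trans (tri-step {q = Sum s t} d pot b≤) (tri-mono (≤-reflexive q+d≡)))
    , ≤-trans b′≤ (≤-trans (+-monoˡ-≤ d (≤-trans b≤ (m∸n≤m (Sum s t) 1))) (≤-reflexive q+d≡))
    where
    b′≤ : b (suc t) ≤ b t + d
    b′≤ = s≤s⁻¹ (≤-trans g (≤-reflexive (+-suc (b t) d)))
    q+d≡ : Sum s t + d ≡ Sum s t + suc d ∸ 1
    q+d≡ = cong (_∸ 1) (sym (+-suc (Sum s t) d))

  potential : ∀ {i} → Potential i → ∀ d → i + d ≤ n → Potential (i + d)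
  potential {i} P zero _ = subst Potential (sym (+-identityʳ i)) P
  potential {i} P (suc d) i+d<n = subst Potential (sym (+-suc i d))
    (potential-step i+d<n′ (potential P d (<⇒≤ i+d<n′)))
    where
    i+d<n′ : i + d < n
    i+d<n′ = subst (_≤ n) (+-suc i d) i+d<n

  sparse-b : ∀ {i} → i ≤ n → s i ≡ 0 → b i ≡ 0 → (∀ {t} → t < i → 0 < s t) →
    Sum a (suc n) ≤ tri (p ∸ 1) ⊎ Sum b (suc n) ≤ tri (p ∸ 1)
  sparse-b {i} i≤n s≡0 b≡0 pos with ascent i≤n pos
  ... | inj₁ h = inj₁ (dense (begin
      suc n                 ≡⟨ total i≤n ⟨
      a i + s i + b i + i   ≡⟨ cong (_+ i) (cong₂ (λ x y → a i + x + y) s≡0 b≡0) ⟩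
      a i + 0 + 0 + i       ≡⟨ cong (_+ i) (trans (+-identityʳ _) (+-identityʳ _)) ⟩
      a i + i               ≤⟨ h ⟩
      Sum s i               ≤⟨ Sum-mono s (m≤n⇒m≤1+n i≤n) ⟩
      p                     ∎))
    where open ≤-Reasoning
  ... | inj₂ a-pos with descent i≤n s≡0 b≡0 pos a-pos i 0 refl
  ... | q , refl , b-le , _ = inj₂ (≤-trans
      -- The potential is followed up to row n, and its term `tri (b n)` covers the vertices of row
      -- n itself.
      (+-monoʳ-≤ (Sum b n) (m≤tri (b n)))
      (≤-trans (final .proj₁) (tri-mono (∸-monoˡ-≤ 1 (m≤m+n (Sum s n) (s n))))))
    where
    -- Since `s i` and `b i` vanish, the bound of `descent` at t = 0 is the potential at row i.
    start : Potential i
    start = subst (λ x → Sum b i + tri x ≤ tri (Sum s i ∸ 1) × x ≤ Sum s i ∸ 1) (sym b≡0)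
      (subst (λ x → Sum b i + 0 ≤ tri (x ∸ 1)) (trans (cong (Sum s i +_) s≡0) (+-identityʳ _))
        (subst (λ x → Sum b i + x ≤ tri (Sum s (suc i) ∸ 1)) b≡0 b-le) , z≤n)
    final : Potential n
    final = subst Potential (m+[n∸m]≡n i≤n)
      (potential start (n ∸ i) (≤-reflexive (m+[n∸m]≡n i≤n)))

separation : ∀ {n a s b} → Separated n a s b →
  Sum a (suc n) ≤ tri (Sum s (suc n) ∸ 1) ⊎ Sum b (suc n) ≤ tri (Sum s (suc n) ∸ 1)
separation {n} {a} {s} {b} S with first-zero s (suc n)
... | inj₁ pos = inj₁ (dense S (Sum-positive (suc n) pos))
... | inj₂ (i , s≤s i≤n , s≡0 , pos) with Separated.pure S i≤n s≡0
... | inj₁ a≡0 = swap (sparse-b (Separated-sym S) i≤n s≡0 a≡0 pos)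
... | inj₂ b≡0 = sparse-b S i≤n s≡0 b≡0 pos

-- 0/1 sequences along rows.

Sum-partition : ∀ {f g h} m → (∀ i → f i + g i + h i ≡ 1) → Sum f m + Sum g m + Sum h m ≡ m
Sum-partition zero _ = refl
Sum-partition {f} {g} {h} (suc m) one = trans
  (solve 6 (λ x y z x′ y′ z′ → (x :+ x′) :+ (y :+ y′) :+ (z :+ z′) := x′ :+ y′ :+ z′ :+ (x :+ y :+ z)) refl
    (Sum f m) (Sum g m) (Sum h m) (f m) (g m) (h m))
  (cong₂ _+_ (one m) (Sum-partition m one))
  where open +-*-Solver

Sum-≤ : ∀ {g} m → (∀ i → g i ≤ 1) → Sum g m ≤ m
Sum-≤ zero _ = z≤n
Sum-≤ (suc m) g≤1 = ≤-trans (+-mono-≤ (Sum-≤ m g≤1) (g≤1 m)) (≤-reflexive (+-comm m 1))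

-- A nonempty set F of positions in the upper row excludes F and F + 1 in the lower row, hence at
-- least |F| + 1 of its m + 1 positions. Past the first element of F, each new pair `f m`,
-- `g (suc m)` contributes at most one.
shifted-disjoint : ∀ {f g} m → (∀ i → f i + g i ≤ 1) → (∀ i → f i + g (suc i) ≤ 1) →
  Sum f m ≡ 0 ⊎ Sum f m + Sum g (suc m) ≤ m
shifted-disjoint zero _ _ = inj₁ refl
shifted-disjoint {f} {g} (suc m) same next with shifted-disjoint m same next
... | inj₂ h = inj₂ (begin
    Sum f m + f m + (Sum g (suc m) + g (suc m)) ≡⟨ solve 4 (λ x y z w → x :+ y :+ (z :+ w) := y :+ w :+ (x :+ z)) refl (Sum f m) (f m) (Sum g (suc m)) (g (suc m)) ⟩
    f m + g (suc m) + (Sum f m + Sum g (suc m)) ≤⟨ +-mono-≤ (next m) h ⟩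
    suc m                                       ∎)
  where
  open ≤-Reasoning
  open +-*-Solver
... | inj₁ z with f m | same m | next m
... | zero | _ | _ = inj₁ (trans (+-identityʳ _) z)
-- Position m is the first element of F. Both `g m` and `g (suc m)` vanish, which is where the extra
-- excluded position is gained.
... | suc x | s≤s h | s≤s h′ = inj₂ (begin
    Sum f m + suc x + (Sum g m + g m + g (suc m)) ≡⟨ cong₂ (λ y w → y + suc x + (Sum g m + w + g (suc m))) z (m+n≡0⇒n≡0 x (n≤0⇒n≡0 h)) ⟩
    suc x + (Sum g m + 0 + g (suc m))             ≡⟨ cong₂ (λ y w → suc y + (Sum g m + 0 + w)) (m+n≡0⇒m≡0 x (n≤0⇒n≡0 h)) (m+n≡0⇒n≡0 x (n≤0⇒n≡0 h′)) ⟩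
    suc (Sum g m + 0 + 0)                         ≡⟨ cong suc (trans (+-identityʳ _) (+-identityʳ _)) ⟩
    suc (Sum g m)                                 ≤⟨ s≤s (Sum-≤ m (λ i → m+n≤o⇒n≤o (f i) (same i))) ⟩
    suc m                                         ∎)
  where open ≤-Reasoning

-- The last position is recorded in the conclusion because its class is what forces the class of the
-- next one.
monochromatic : ∀ {f s g} m → (∀ i → f i + s i + g i ≡ 1) →
  (∀ i → f i + g (suc i) ≤ 1) → (∀ i → g i + f (suc i) ≤ 1) →
  Sum s (suc m) ≡ 0 → (Sum f (suc m) ≡ 0 × g m ≡ 1) ⊎ (Sum g (suc m) ≡ 0 × f m ≡ 1)
monochromatic {f} {s} {g} zero one _ _ s≡0 with f 0 | s 0 | g 0 | one 0 | s≡0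
... | zero | .0 | .1 | refl | refl = inj₁ (refl , refl)
... | suc x | .0 | y | h | refl = inj₂
  ( m+n≡0⇒n≡0 (x + 0) (suc-injective h)
  , cong suc (m+n≡0⇒m≡0 x (m+n≡0⇒m≡0 (x + 0) (suc-injective h))))
monochromatic {f} {s} {g} (suc m) one fg gf s≡0
  with monochromatic m one fg gf (m+n≡0⇒m≡0 (Sum s (suc m)) s≡0) | one (suc m)
... | inj₁ (z , g≡1) | h = inj₁
  ( trans (cong₂ _+_ z f≡0) refl
  , trans (sym (cong₂ (λ x y → x + y + g (suc m)) f≡0 (m+n≡0⇒n≡0 (Sum s (suc m)) s≡0))) h)
  where
  f≡0 : f (suc m) ≡ 0
  f≡0 = n≤0⇒n≡0 (s≤s⁻¹ (subst (λ x → x + f (suc m) ≤ 1) g≡1 (gf m)))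
... | inj₂ (z , f≡1) | h = inj₂
  ( cong₂ _+_ z g≡0
  , trans (sym (trans (cong₂ (λ x y → f (suc m) + x + y) (m+n≡0⇒n≡0 (Sum s (suc m)) s≡0) g≡0) (trans (+-identityʳ _) (+-identityʳ _)))) h)
  where
  g≡0 : g (suc m) ≡ 0
  g≡0 = n≤0⇒n≡0 (s≤s⁻¹ (subst (λ x → x + g (suc m) ≤ 1) f≡1 (fg m)))

-- Counting vertices row by row.

indicator : ∀ {P : Set} → Dec P → ℕ
indicator (yes _) = 1
indicator (no _) = 0

Sum-cong : ∀ {f g} m → (∀ i → f i ≡ g i) → Sum f m ≡ Sum g m
Sum-cong zero _ = refl
Sum-cong (suc m) eq = cong₂ _+_ (Sum-cong m eq) (eq m)

-- The bridge from list lengths to `Sum`, applied both to the list of rows and to the positions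
-- within a row.
additive-upTo : (φ : List ℕ → ℕ) → φ [] ≡ 0 → (∀ xs ys → φ (xs ++ ys) ≡ φ xs + φ ys) →
  ∀ m → φ (upTo m) ≡ Sum (λ i → φ (i ∷ [])) m
additive-upTo φ base additive zero = base
additive-upTo φ base additive (suc m) = begin
  φ (upTo (suc m))                       ≡⟨ cong φ (upTo-∷ʳ m) ⟨
  φ (upTo m ++ m ∷ [])                   ≡⟨ additive (upTo m) (m ∷ []) ⟩
  φ (upTo m) + φ (m ∷ [])                ≡⟨ cong (_+ φ (m ∷ [])) (additive-upTo φ base additive m) ⟩
  Sum (λ i → φ (i ∷ [])) m + φ (m ∷ []) ∎
  where open ≡-Reasoning

length-rows : ∀ n m → length (concatMap (row n) (upTo m)) ≡ Sum (λ j → suc (n ∸ j)) m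
length-rows n m = trans
  (additive-upTo (length ∘ concatMap (row n)) refl
    (λ xs ys → trans (cong length (concatMap-++ (row n) xs ys)) (length-++ (concatMap (row n) xs))) m)
  (Sum-cong m λ j → trans (cong length (++-identityʳ (row n j)))
    (trans (length-map (_, j) (upTo (suc (n ∸ j)))) (length-upTo (suc (n ∸ j)))))

module _ {P : Vertex → Set} (P? : Decidable P) where

  private
    length-filter-++ : ∀ xs ys → length (filter P? (xs ++ ys)) ≡ length (filter P? xs) + length (filter P? ys)
    length-filter-++ xs ys = trans (cong length (filter-++ P? xs ys)) (length-++ (filter P? xs))

    length-filter-singleton : ∀ v → length (filter P? (v ∷ [])) ≡ indicator (P? v)
    length-filter-singleton v with P? v
    ... | yes _ = refl
    ... | no _ = refl

  rowCount : ℕ → ℕ → ℕ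
  rowCount n j = Sum (λ i → indicator (P? (i , j))) (suc (n ∸ j))

  length-filter-vertices : ∀ n → length (filter P? (vertices n)) ≡ Sum (rowCount n) (suc n)
  length-filter-vertices n = trans
    (additive-upTo (length ∘ filter P? ∘ concatMap (row n)) refl
      (λ xs ys → trans (cong (length ∘ filter P?) (concatMap-++ (row n) xs ys)) (length-filter-++ (concatMap (row n) xs) _))
      (suc n))
    (Sum-cong (suc n) λ j → trans (cong (length ∘ filter P?) (++-identityʳ (row n j))) (trans
      (additive-upTo (length ∘ filter P? ∘ map (_, j)) refl
        (λ xs ys → trans (cong (length ∘ filter P?) (map-++ (_, j) xs ys)) (length-filter-++ (map (_, j) xs) _))
        (suc (n ∸ j)))
      (Sum-cong (suc (n ∸ j)) λ i → length-filter-singleton (i , j))))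

-- The row profile of a vertex set.

module _ (A : List Vertex) where

  Outside : Vertex → Set
  Outside v = v ∉ A × ¬ OnBoundary A v

  outside? : Decidable Outside
  outside? v = ¬? (v ∈V? A) ×-dec ¬? (onBoundary? A v)

  private
    α σ β : Vertex → ℕ
    α v = indicator (v ∈V? A)
    σ v = indicator (onBoundary? A v)
    β v = indicator (outside? v)

  partition : ∀ v → α v + σ v + β v ≡ 1
  partition v with v ∈V? A | onBoundary? A v | outside? v
  ... | yes v∈A | yes (v∉A , _) | _ = ⊥-elim (v∉A v∈A)
  ... | yes v∈A | no _ | yes (v∉A , _) = ⊥-elim (v∉A v∈A)
  ... | yes _ | no _ | no _ = refl
  ... | no _ | yes v∈∂ | yes (_ , v∉∂) = ⊥-elim (v∉∂ v∈∂)
  ... | no _ | yes _ | no _ = refl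
  ... | no _ | no _ | yes _ = refl
  ... | no v∉A | no v∉∂ | no ¬out = ⊥-elim (¬out (v∉A , v∉∂))

  nonadjacent : ∀ {u v} → Adj v u → α u + β v ≤ 1
  nonadjacent {u} {v} v~u with u ∈V? A | outside? v
  ... | yes u∈A | yes (v∉A , v∉∂) = ⊥-elim (v∉∂ (v∉A , lose u∈A v~u))
  ... | yes _ | no _ = ≤-refl
  ... | no _ | yes _ = ≤-refl
  ... | no _ | no _ = z≤n

  nonadjacent′ : ∀ {u v} → Adj v u → β v + α u ≤ 1
  nonadjacent′ {u} {v} v~u = subst (_≤ 1) (+-comm (α u) (β v)) (nonadjacent v~u)

  separated : ∀ n → Separated n (rowCount (_∈V? A) n) (rowCount (onBoundary? A) n) (rowCount outside? n)
  separated n = record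
    { total = λ {t} t≤n → trans (cong (_+ t) (Sum-partition (suc (n ∸ t)) (λ i → partition (i , t))))
        (cong suc (m∸n+n≡m t≤n))
    ; pure = λ {t} _ s≡0 → [ inj₁ ∘ proj₁ , inj₂ ∘ proj₁ ]′ (monochromatic (n ∸ t)
        (λ i → partition (i , t))
        (λ i → nonadjacent (inj₂ (inj₁ (refl , refl))))
        (λ i → nonadjacent′ (inj₁ (inj₁ (refl , refl)))) s≡0)
    -- The lower neighbours of (i , t + 1) are (i , t) and (i + 1 , t); they give the aligned and
    -- the shifted condition of `shifted-disjoint`.
    ; above-a = λ t<n → above t<n
        (λ i → nonadjacent (inj₁ (inj₂ (inj₁ (refl , refl)))))
        (λ i → nonadjacent (inj₁ (inj₂ (inj₂ (refl , refl)))))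
    ; above-b = λ t<n → above t<n
        (λ i → nonadjacent′ (inj₂ (inj₂ (inj₁ (refl , refl)))))
        (λ i → nonadjacent′ (inj₂ (inj₂ (inj₂ (refl , refl)))))
    }
    where
    above : ∀ {f g t} → t < n → (∀ i → f i + g i ≤ 1) → (∀ i → f i + g (suc i) ≤ 1) →
      Sum f (suc (n ∸ suc t)) ≡ 0 ⊎ Sum f (suc (n ∸ suc t)) + Sum g (suc (n ∸ t)) + t ≤ n
    above {f} {g} {t} t<n same next =
      subst (λ m → Sum f m ≡ 0 ⊎ Sum f m + Sum g (suc (n ∸ t)) + t ≤ n) (+-∸-assoc 1 t<n)
        (map₂ (λ h → ≤-trans (+-monoˡ-≤ t h) (≤-reflexive (m∸n+n≡m (<⇒≤ t<n))))
          (shifted-disjoint (n ∸ t) same next))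

-- Duplicate-free lists and the filling order of the grid.

length-⊆ : ∀ {xs ys : List Vertex} → Unique xs → xs ⊆ ys → length xs ≤ length ys
length-⊆ {[]} _ _ = z≤n
length-⊆ {x ∷ xs} {ys} (x∉xs ∷ xs!) sub with ls , rs , refl ← ∈-∃++ (sub (here refl)) =
  ≤-trans (s≤s (length-⊆ xs! sub′)) (≤-reflexive (sym (length-++-sucʳ ls x rs)))
  where
  sub′ : xs ⊆ ls ++ rs
  sub′ u∈xs with ∈-++⁻ ls (sub (there u∈xs))
  ... | inj₁ u∈ls = ∈-++⁺ˡ u∈ls
  ... | inj₂ (here refl) = ⊥-elim (lookupAll x∉xs u∈xs refl)
  ... | inj₂ (there u∈rs) = ∈-++⁺ʳ ls u∈rs

_≺_ : Vertex → Vertex → Set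
(a , b) ≺ (c , d) = b < d ⊎ (b ≡ d × a < c)

≺⇒≢ : ∀ {u v} → u ≺ v → u ≢ v
≺⇒≢ (inj₁ b<b) refl = <-irrefl refl b<b
≺⇒≢ (inj₂ (_ , a<a)) refl = <-irrefl refl a<a

∈-row⁻ : ∀ {n j u} → u ∈ row n j → proj₂ u ≡ j × proj₁ u ≤ n ∸ j
∈-row⁻ u∈ with i , i∈ , refl ← ∈-map⁻ _ u∈ = refl , s≤s⁻¹ (∈-upTo⁻ i∈)

∈-vertices⁺ : ∀ {n u} → InT n u → u ∈ vertices n
∈-vertices⁺ {n} {a , b} a+b≤n = ∈-concatMap⁺ (row n) (lose (∈-upTo⁺ (s≤s (m+n≤o⇒n≤o a a+b≤n)))
  (∈-map⁺ (_, b) (∈-upTo⁺ (s≤s (m+n≤o⇒m≤o∸n a a+b≤n)))))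

∈-vertices⁻ : ∀ {n u} → u ∈ vertices n → InT n u
∈-vertices⁻ {n} {a , b} u∈ with j , j∈ , u∈row ← find (∈-concatMap⁻ (row n) {xs = upTo (suc n)} u∈)
  with refl , a≤ ← ∈-row⁻ {n} {j} u∈row = m≤o∸n⇒m+n≤o a (s≤s⁻¹ (∈-upTo⁻ j∈)) a≤

vertices-sorted : ∀ n → AllPairs _≺_ (vertices n)
vertices-sorted n = concat⁺
  (All-map⁺ (tabulate λ {j} _ → AllPairs-map⁺ (applyUpTo⁺₁ id (suc (n ∸ j)) λ i<k _ → inj₂ (refl , i<k))))
  (AllPairs-map⁺ (applyUpTo⁺₁ id (suc n) λ {i} {j} i<j _ → tabulate λ u∈ → tabulate λ v∈ → inj₁
    (subst (_< _) (sym (proj₁ (∈-row⁻ {n} {i} u∈))) (subst (i <_) (sym (proj₁ (∈-row⁻ {n} {j} v∈))) i<j))))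

vertices-unique : ∀ n → Unique (vertices n)
vertices-unique n = mapPairs ≺⇒≢ (vertices-sorted n)

Sum-widths : ∀ n m d → m + d ≡ suc n → Sum (λ j → suc (n ∸ j)) m + tri d ≡ tri (suc n)
Sum-widths n zero d refl = refl
Sum-widths n (suc m) d eq = begin
  Sum (λ j → suc (n ∸ j)) m + suc (n ∸ m) + tri d   ≡⟨ +-assoc (Sum (λ j → suc (n ∸ j)) m) (suc (n ∸ m)) (tri d) ⟩
  Sum (λ j → suc (n ∸ j)) m + (suc (n ∸ m) + tri d) ≡⟨ cong (Sum (λ j → suc (n ∸ j)) m +_) (+-comm (suc (n ∸ m)) (tri d)) ⟩
  Sum (λ j → suc (n ∸ j)) m + (tri d + suc (n ∸ m)) ≡⟨ cong (λ x → Sum (λ j → suc (n ∸ j)) m + (tri d + suc x)) n∸m≡d ⟩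
  Sum (λ j → suc (n ∸ j)) m + tri (suc d)           ≡⟨ Sum-widths n m (suc d) (trans (+-suc m d) eq) ⟩
  tri (suc n)                                       ∎
  where
  open ≡-Reasoning
  n∸m≡d : n ∸ m ≡ d
  n∸m≡d = trans (cong (_∸ m) (sym (suc-injective eq))) (m+n∸m≡n m d)

numVertices≡tri : ∀ n → numVertices n ≡ tri (suc n)
numVertices≡tri n = trans (length-rows n (suc n)) (trans (sym (+-identityʳ _)) (Sum-widths n (suc n) 0 (+-identityʳ _)))

-- Cuts of the filling order.

AllPairs-split : ∀ {R : Vertex → Vertex → Set} xs {v ys} → AllPairs R (xs ++ v ∷ ys) →
  AllPairs R xs × All (λ u → R u v) xs × All (R v) ys
AllPairs-split [] (v-ys ∷ _) = [] , [] , v-ys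
AllPairs-split (x ∷ xs) (x-rest ∷ rest) with xs! , xs-v , v-ys ← AllPairs-split xs rest =
  ++⁻ˡ xs x-rest ∷ xs! , lookupAll x-rest (∈-++⁺ʳ xs (here refl)) ∷ xs-v , v-ys

-- Going down one row, the column stays or grows; this decides on which side of the cut column a
-- neighbour lies.
adjacent-rows : ∀ {x y x′ y′} → Adj (x , y) (x′ , y′) →
  y ≡ y′ ⊎ (y ≡ suc y′ × x ≤ x′) ⊎ (y′ ≡ suc y × x′ ≤ x)
adjacent-rows (inj₁ (inj₁ (_ , refl))) = inj₁ refl
adjacent-rows (inj₁ (inj₂ (inj₁ (refl , refl)))) = inj₂ (inj₂ (refl , ≤-refl))
adjacent-rows (inj₁ (inj₂ (inj₂ (refl , refl)))) = inj₂ (inj₂ (refl , n≤1+n _))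
adjacent-rows (inj₂ (inj₁ (_ , refl))) = inj₁ refl
adjacent-rows (inj₂ (inj₂ (inj₁ (refl , refl)))) = inj₂ (inj₁ (refl , ≤-refl))
adjacent-rows (inj₂ (inj₂ (inj₂ (refl , refl)))) = inj₂ (inj₁ (refl , n≤1+n _))

-- A row packing short of the whole grid is such an `xs`, and a nonempty ice cream cone is such a
-- `(c , j) ∷ ys`, so one analysis of a cut serves both packings.
module Cut {n c j xs ys} (cut : vertices n ≡ xs ++ (c , j) ∷ ys) where

  private
    v : Vertex
    v = c , j

    v∈ : v ∈ vertices n
    v∈ = subst (v ∈_) (sym cut) (∈-++⁺ʳ xs (here refl))

    split = AllPairs-split xs (subst (AllPairs _≺_) cut (vertices-sorted n))

    before : ∀ {u} → u ∈ xs → u ≺ v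
    before = lookupAll (proj₁ (proj₂ split))

    after : ∀ {x y} → (x , y) ∈ v ∷ ys → j < y ⊎ (j ≡ y × c ≤ x)
    after (here refl) = inj₂ (refl , ≤-refl)
    after (there u∈) = map₂ (λ (eq , lt) → eq , <⇒≤ lt)
      (lookupAll (proj₂ (proj₂ split)) u∈)

    side : ∀ {u} → u ∈ vertices n → u ∈ xs ⊎ u ∈ v ∷ ys
    side u∈ = ∈-++⁻ xs (subst (_ ∈_) cut u∈)

    -- The boundary of either side of the cut has at most one vertex in each column: one row for the
    -- columns left of the cut vertex, a neighbouring row for the others.
    fan : ℕ → ℕ → ℕ → List Vertex
    fan y y′ m = map (λ i → i , (if does (i <? c) then y else y′)) (upTo m)

    ∈-fan-< : ∀ {y y′ m x} → x < m → x < c → (x , y) ∈ fan y y′ m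
    ∈-fan-< {y} {y′} {m} {x} x<m x<c =
      subst (λ b → (x , (if b then y else y′)) ∈ fan y y′ m) (dec-true (x <? c) x<c) (∈-map⁺ _ (∈-upTo⁺ x<m))

    ∈-fan-≥ : ∀ {y y′ m x} → x < m → c ≤ x → (x , y′) ∈ fan y y′ m
    ∈-fan-≥ {y} {y′} {m} {x} x<m c≤x =
      subst (λ b → (x , (if b then y else y′)) ∈ fan y y′ m) (dec-false (x <? c) (≤⇒≯ c≤x)) (∈-map⁺ _ (∈-upTo⁺ x<m))

    boundary-⊆-fan : ∀ {S y y′ m} → (∀ {u} → u ∈ vertices n → OnBoundary S u → u ∈ fan y y′ m) →
      length (boundary n S) ≤ m
    boundary-⊆-fan {S} {y} {y′} {m} sub = ≤-trans
      (length-⊆ (Unique-filter⁺ (onBoundary? S) (vertices-unique n))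
        (λ u∈ → let u∈V , u∈∂ = ∈-filter⁻ (onBoundary? S) u∈ in sub u∈V u∈∂))
      (≤-reflexive (trans (length-map _ (upTo m)) (length-upTo m)))

    width : ∀ {x y} → (x , y) ∈ vertices n → x ≤ n ∸ y
    width {x} x∈ = m+n≤o⇒m≤o∸n x (∈-vertices⁻ x∈)

  -- The boundary lies in row j from column c on and in row j + 1 left of column c, hence in columns
  -- 0 to n - j.
  boundary-before : length (boundary n xs) ≤ suc (n ∸ j)
  boundary-before = boundary-⊆-fan {xs} {suc j} {j} λ u∈V (u∉xs , near) → on-fan u∈V u∉xs (find near)
    where
    on-fan : ∀ {x y} → (x , y) ∈ vertices n → (x , y) ∉ xs → ∃[ w ] (w ∈ xs × Adj (x , y) w) →
      (x , y) ∈ fan (suc j) j (suc (n ∸ j))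
    on-fan {x} {y} u∈V u∉xs (w , w∈xs , u~w) with side u∈V
    ... | inj₁ u∈xs = ⊥-elim (u∉xs u∈xs)
    ... | inj₂ u∈ with after u∈
    ... | inj₂ (refl , c≤x) = ∈-fan-≥ (s≤s (width u∈V)) c≤x
    ... | inj₁ j<y with adjacent-rows u~w | before w∈xs
    ... | inj₁ refl | inj₁ y<j = ⊥-elim (<-asym j<y y<j)
    ... | inj₁ refl | inj₂ (refl , _) = ⊥-elim (<-irrefl refl j<y)
    ... | inj₂ (inj₁ (refl , _)) | inj₁ y≤j = ⊥-elim (<-irrefl refl (<-≤-trans y≤j (s≤s⁻¹ j<y)))
    -- The one possible case above row j: w is in row j left of column c, and going up cannot
    -- increase the column.
    ... | inj₂ (inj₁ (refl , x≤)) | inj₂ (refl , w<c) =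
      ∈-fan-< (s≤s (≤-trans (width u∈V) (∸-monoʳ-≤ n (n≤1+n j)))) (≤-<-trans x≤ w<c)
    ... | inj₂ (inj₂ (refl , _)) | inj₁ y<j = ⊥-elim (<-asym j<y (<⇒≤ y<j))
    ... | inj₂ (inj₂ (refl , _)) | inj₂ (refl , _) = ⊥-elim (<-asym j<y ≤-refl)

  -- The boundary lies in row j left of column c and in row j - 1 from column c on; row j - 1 has
  -- one more column, whence the second `suc`. For j = 0 no vertex lies below row j, so the default
  -- `pred 0` never receives one.
  boundary-after : length (boundary n (v ∷ ys)) ≤ suc (suc (n ∸ j))
  boundary-after = boundary-⊆-fan {v ∷ ys} {j} {pred j} λ u∈V (u∉ , near) → on-fan u∈V u∉ (find near)
    where
    n∸y≤ : ∀ y → n ∸ y ≤ suc (n ∸ suc y)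
    n∸y≤ y = ≤-trans (m≤n+m∸n (n ∸ y) 1) (≤-reflexive (cong suc (trans (∸-+-assoc n y 1) (cong (n ∸_) (+-comm y 1)))))
    on-fan : ∀ {x y} → (x , y) ∈ vertices n → (x , y) ∉ v ∷ ys → ∃[ w ] (w ∈ v ∷ ys × Adj (x , y) w) →
      (x , y) ∈ fan j (pred j) (suc (suc (n ∸ j)))
    on-fan {x} {y} u∈V u∉ (w , w∈ , u~w) with side u∈V
    ... | inj₂ u∈ = ⊥-elim (u∉ u∈)
    ... | inj₁ u∈ with before u∈
    ... | inj₂ (refl , x<c) = ∈-fan-< (m≤n⇒m≤1+n (s≤s (width u∈V))) x<c
    ... | inj₁ y<j with adjacent-rows u~w | after w∈
    ... | inj₁ refl | inj₁ j<y = ⊥-elim (<-asym j<y y<j)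
    ... | inj₁ refl | inj₂ (refl , _) = ⊥-elim (<-irrefl refl y<j)
    ... | inj₂ (inj₁ (refl , _)) | inj₁ j<y = ⊥-elim (<-asym y<j (m<n⇒m<1+n j<y))
    ... | inj₂ (inj₁ (refl , _)) | inj₂ (refl , _) = ⊥-elim (<-asym y<j ≤-refl)
    ... | inj₂ (inj₂ (refl , _)) | inj₁ j≤y = ⊥-elim (<-irrefl refl (<-≤-trans y<j (s≤s⁻¹ j≤y)))
    ... | inj₂ (inj₂ (refl , w≤x)) | inj₂ (refl , c≤w) =
      ∈-fan-≥ (s≤s (≤-trans (width u∈V) (n∸y≤ y))) (≤-trans c≤w w≤x)

  -- Besides the cut vertex, this side contains all rows above j, of lengths n - j, ..., 1. The
  -- count is made on the complement: `xs` fits into the rows below j and c ≤ n - j vertices of row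
  -- j.
  tri<length-after : tri (n ∸ j) < length (v ∷ ys)
  tri<length-after = +-cancelˡ-< (length xs + (n ∸ j)) _ _ (begin-strict
    length xs + (n ∸ j) + tri (n ∸ j)                 <⟨ n<1+n _ ⟩
    suc (length xs + (n ∸ j) + tri (n ∸ j))           ≡⟨ solve 3 (λ x y z → con 1 :+ (x :+ y :+ z) := x :+ (z :+ (con 1 :+ y))) refl (length xs) (n ∸ j) (tri (n ∸ j)) ⟩
    length xs + tri (suc (n ∸ j))                     ≤⟨ +-monoˡ-≤ _ (length-⊆ xs-unique xs-⊆) ⟩
    length (lower ++ map (_, j) (upTo c)) + tri (suc (n ∸ j))
      ≡⟨ cong (_+ tri (suc (n ∸ j))) (trans (length-++ lower) (cong (length lower +_) (trans (length-map _ (upTo c)) (length-upTo c)))) ⟩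
    length lower + c + tri (suc (n ∸ j))              ≡⟨ solve 3 (λ x y z → x :+ y :+ z := x :+ z :+ y) refl (length lower) c (tri (suc (n ∸ j))) ⟩
    length lower + tri (suc (n ∸ j)) + c              ≡⟨ cong (_+ c) (trans (cong (_+ tri (suc (n ∸ j))) (length-rows n j)) (Sum-widths n j (suc (n ∸ j)) (trans (+-suc j (n ∸ j)) (cong suc (m+[n∸m]≡n j≤n))))) ⟩
    tri (suc n) + c                                   ≡⟨ cong (_+ c) (numVertices≡tri n) ⟨
    length (vertices n) + c                           ≤⟨ +-mono-≤ (≤-reflexive (trans (cong length cut) (length-++ xs))) (width v∈) ⟩
    length xs + length (v ∷ ys) + (n ∸ j)             ≡⟨ solve 3 (λ x y z → x :+ y :+ z := x :+ z :+ y) refl (length xs) (length (v ∷ ys)) (n ∸ j) ⟩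
    length xs + (n ∸ j) + length (v ∷ ys)             ∎)
    where
    open ≤-Reasoning
    open +-*-Solver
    lower : List Vertex
    lower = concatMap (row n) (upTo j)
    j≤n : j ≤ n
    j≤n = m+n≤o⇒n≤o c (∈-vertices⁻ v∈)
    xs-unique : Unique xs
    xs-unique = mapPairs ≺⇒≢ (proj₁ split)
    xs-⊆ : xs ⊆ lower ++ map (_, j) (upTo c)
    xs-⊆ {x , y} u∈ with before u∈
    ... | inj₁ y<j = ∈-++⁺ˡ (∈-concatMap⁺ (row n) (lose (∈-upTo⁺ y<j) (∈-map⁺ (_, y)
            (∈-upTo⁺ (s≤s (width (subst (_ ∈_) (sym cut) (∈-++⁺ˡ u∈))))))))
    ... | inj₂ (refl , x<c) = ∈-++⁺ʳ lower (∈-map⁺ (_, j) (∈-upTo⁺ x<c))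

-- Boundaries of the two packings.

boundary-none : ∀ n {S} → (∀ {v} → v ∈ vertices n → ¬ OnBoundary S v) → length (boundary n S) ≡ 0
boundary-none n {S} none = cong length (filter-none (onBoundary? S) (tabulate none))

<-pred⇒2+≤ : ∀ {m p} → m < p ∸ 1 → suc (suc m) ≤ p
<-pred⇒2+≤ {p = suc p} m<p = s≤s m<p

tri-cancel-< : ∀ {m k} → tri m < tri k → m < k
tri-cancel-< lt = ≰⇒> λ k≤m → <⇒≱ lt (tri-mono k≤m)

-- If the cut vertex is in row j, then T(n - j) < |V| - k ≤ T(p), so n - j < p, and the boundary has
-- at most n - j + 1 vertices.
row-boundary : ∀ n k p → numVertices n ∸ k ≤ tri p → length (boundary n (rowPacking n k)) ≤ p
row-boundary n k p small with drop k (vertices n) | take++drop≡id k (vertices n) | length-drop k (vertices n)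
... | [] | cut | _ = ≤-trans (≤-reflexive (boundary-none n λ v∈ (v∉ , _) →
      v∉ (subst (_ ∈_) (trans (sym cut) (++-identityʳ _)) v∈))) z≤n
... | (c , j) ∷ ys | cut | len = ≤-trans boundary-before
      (tri-cancel-< (<-≤-trans tri<length-after (≤-trans (≤-reflexive len) small)))
  where open Cut {n} {c} {j} (sym cut)

-- Here T(n - j) < k ≤ T(p - 1), and the stricter bound n - j < p - 1 makes room for the n - j + 2
-- possible boundary vertices.
ice-cream-boundary : ∀ n k p → k ≤ numVertices n → k ≤ tri (p ∸ 1) → length (boundary n (iceCream n k)) ≤ p
ice-cream-boundary n k p k≤N small
  with drop (numVertices n ∸ k) (vertices n) | take++drop≡id (numVertices n ∸ k) (vertices n)
     | length-drop (numVertices n ∸ k) (vertices n)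
... | [] | _ | _ = ≤-trans (≤-reflexive (boundary-none n {[]} λ { _ (_ , ()) })) z≤n
... | (c , j) ∷ ys | cut | len = ≤-trans boundary-after (<-pred⇒2+≤
      (tri-cancel-< (<-≤-trans tri<length-after (≤-trans (≤-reflexive (trans len (m∸[m∸n]≡n k≤N))) small))))
  where open Cut {n} {c} {j} (sym cut)

-- From row counts back to vertex sets.

length-filter-∈ : ∀ n {A} → Unique A → All (InT n) A → length (filter (_∈V? A) (vertices n)) ≡ length A
length-filter-∈ n {A} A! A⊆T = ≤-antisym
  (length-⊆ (Unique-filter⁺ (_∈V? A) (vertices-unique n)) λ v∈ → proj₂ (∈-filter⁻ (_∈V? A) {xs = vertices n} v∈))
  (length-⊆ A! λ v∈ → ∈-filter⁺ (_∈V? A) (∈-vertices⁺ (lookupAll A⊆T v∈)) v∈)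

theorem1 : (n : ℕ) → 1 ≤ n → (k : ℕ) → k ≤ numVertices n →
    (A : List Vertex) → Unique A → All (InT n) A → length A ≡ k →
    length (boundary n (rowPacking n k)) ⊓ length (boundary n (iceCream n k))
    ≤ length (boundary n A)
theorem1 n _ k k≤N A A! A⊆T refl = [ few-inside , few-outside ]′ (separation S)
  where
  open ≤-Reasoning
  S = separated A n
  a = rowCount (_∈V? A) n
  s = rowCount (onBoundary? A) n
  b = rowCount (outside? A) n
  p = Sum s (suc n)

  ΣA≡k : Sum a (suc n) ≡ k
  ΣA≡k = trans (sym (length-filter-vertices (_∈V? A) n)) (length-filter-∈ n A! A⊆T)

  p≡ : p ≡ length (boundary n A)
  p≡ = sym (length-filter-vertices (onBoundary? A) n)

  few-inside : Sum a (suc n) ≤ tri (p ∸ 1) → _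
  few-inside small = ≤-trans (m⊓n≤n _ _) (ice-cream-boundary n k _ k≤N
    (subst (λ q → k ≤ tri (q ∸ 1)) p≡ (subst (_≤ tri (p ∸ 1)) ΣA≡k small)))

  -- The complement of A consists of its boundary and B, so |V| - k = p + |B| ≤ p + T(p - 1) = T(p).
  few-outside : Sum b (suc n) ≤ tri (p ∸ 1) → _
  few-outside small = ≤-trans (m⊓n≤m _ _) (row-boundary n k _ (subst (λ q → numVertices n ∸ k ≤ tri q) p≡ (begin
    numVertices n ∸ k                                        ≡⟨ cong (_∸ k) (numVertices≡tri n) ⟩
    tri (suc n) ∸ k                                          ≡⟨ cong (_∸ k) (Sum-total S (suc n) 0 (+-identityʳ _)) ⟨
    Sum a (suc n) + p + Sum b (suc n) + 0 ∸ k                ≡⟨ cong (_∸ k) (trans (+-identityʳ _) (+-assoc (Sum a (suc n)) p _)) ⟩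
    Sum a (suc n) + (p + Sum b (suc n)) ∸ k                  ≡⟨ cong (λ x → x + (p + Sum b (suc n)) ∸ k) ΣA≡k ⟩
    k + (p + Sum b (suc n)) ∸ k                              ≡⟨ m+n∸m≡n k _ ⟩
    p + Sum b (suc n)                                        ≤⟨ +-monoʳ-≤ p small ⟩
    p + tri (p ∸ 1)                                          ≡⟨ trans (+-comm p _) (tri-pred p) ⟩
    tri p                                                    ∎)))
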